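{- Let $n\ge 2$ be an even integer and let $\tilde S_n$ act on $\tilde I^{\mathsf{FPF}}_n$ by conjugation, $w\cdot z = wzw^{ -1}$. Then the pair $(\tilde I^{\mathsf{FPF}}_n,\hat\ell_{\mathsf{FPF}})$ is a quasiparabolic $\tilde S_n$-set (with respect to the simple generators $S=\{s_1,\dots,s_n\}$).
   Context: The affine symmetric group $\tilde S_n$ is the group of bijections $\pi:\mathbb Z\to\mathbb Z$ with $\pi(i+n)=\pi(i)+n$ for all $i\in\mathbb Z$ and $\pi(1)+\dots+\pi(n)=1+\dots+n$. For $i\in\mathbb Z$, $s_i\in\tilde S_n$ interchanges $i+kn$ and $i+1+kn$ for all $k\in\mathbb Z$ and fixes all other integers; $\tilde S_n$ is a Coxeter group with simple generators $S=\{s_1,\dots,s_n\}$ and length function $\ell$. The set of reflections $R(\tilde S_n)=\{wsw^{ -1}: w\in\tilde S_n, s\in S\}$ consists of the elements $t_{ij}$ ($i<j$, $j\not\equiv i \pmod n$) exchanging $i+kn$ and $j+kn$ for all $k$ and fixing all other integers. $\tilde I^{\mathsf{FPF}}_n=\{z\in\tilde S_n: z(z(i))=i \text{ and } z(i)\neq i \text{ for all } i\in\mathbb Z\}$, and $\hat\ell_{\mathsf{FPF}}(z)=\tfrac12(\ell(z)-\tfrac n2)$. For a Coxeter system $(W,S)$ with reflections $R(W)$: a scaled $W$-set is a pair $(X,\mathrm{ht})$ where $X$ is a $W$-set and $\mathrm{ht}:X\to\mathbb Z$ satisfies $|\mathrm{ht}(sx)-\mathrm{ht}(x)|\le 1$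 for all $s\in S$, $x\in X$. A quasiparabolic $W$-set is a scaled $W$-set such that (QP1) for all $r\in R(W)$ and $x\in X$, if $\mathrm{ht}(rx)=\mathrm{ht}(x)$ then $rx=x$; and (QP2) for all $r\in R(W)$, $x\in X$, $s\in S$, if $\mathrm{ht}(rx)>\mathrm{ht}(x)$ and $\mathrm{ht}(srx)<\mathrm{ht}(sx)$ then $rx=sx$. -}

module Defs where

open import Data.Nat as ℕ using (ℕ; zero; suc)
open import Data.Integer using (ℤ; +_; _+_; _-_; ∣_∣; _≤_; _<_; 0ℤ; 1ℤ; -1ℤ)
open import Data.Integer.DivMod using (_%ℕ_; _/ℕ_)
open import Data.List using (List; []; _∷_; foldr; length)
open import Data.List.Relation.Unary.All using (All)
open import Data.Product using (Σ; _×_)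
open import Data.Empty using (⊥)
open import Relation.Nullary using (¬_)
open import Relation.Binary.PropositionalEquality using (_≡_)

record Perm : Set where
  field
    fun    : ℤ → ℤ
    inv    : ℤ → ℤ
    inv∘fun : ∀ i → inv (fun i) ≡ i
    fun∘inv : ∀ i → fun (inv i) ≡ i
open Perm public

_≈_ : Perm → Perm → Set
p ≈ q = ∀ i → fun p i ≡ fun q i

idPerm : Perm
idPerm = record { fun = λ i → i ; inv = λ i → i
                ; inv∘fun = λ i → Relation.Binary.PropositionalEquality.refl
                ; fun∘inv = λ i → Relation.Binary.PropositionalEquality.refl }

_∘ₚ_ : Perm → Perm → Perm
p ∘ₚ q = record
  { fun = λ i → fun p (fun q i)
  ; inv = λ i → inv q (inv p i)
  ; inv∘fun = λ i → Relation.Binary.PropositionalEquality.trans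
                      (Relation.Binary.PropositionalEquality.cong (inv q) (inv∘fun p (fun q i)))
                      (inv∘fun q i)
  ; fun∘inv = λ i → Relation.Binary.PropositionalEquality.trans
                      (Relation.Binary.PropositionalEquality.cong (fun p) (fun∘inv q (inv p i)))
                      (fun∘inv p i)
  }

_⁻¹ : Perm → Perm
p ⁻¹ = record { fun = inv p ; inv = fun p ; inv∘fun = fun∘inv p ; fun∘inv = inv∘fun p }

conj : Perm → Perm → Perm
conj w z = w ∘ₚ (z ∘ₚ (w ⁻¹))

prod : List Perm → Perm
prod = foldr _∘ₚ_ idPerm

sumTo : (ℤ → ℤ) → ℕ → ℤ
sumTo f zero    = 0ℤ
sumTo f (suc k) = sumTo f k + f (+ suc k)

-- j mod n as a natural number (n = 0 never used in the theorem)
modN : ℕ → ℤ → ℕ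
modN zero    j = 0
modN (suc k) j = j %ℕ suc k

module Aff (n : ℕ) where

  InW : Perm → Set
  InW p = (∀ i → fun p (i + + n) ≡ fun p i + + n)
        × (sumTo (fun p) n ≡ sumTo (λ i → i) n)

  -- (j - i) mod n = 0 ⇒ j ↦ j+1 ; (j - i) mod n = 1 ⇒ j ↦ j-1 (uses n ≥ 2)
  -- the map s_i : swaps i + kn and i + 1 + kn for all k, fixes the rest
  sfun : ℤ → ℤ → ℤ
  sfun i j with modN n (j - i)
  ... | zero = j + 1ℤ
  ... | suc zero    = j - 1ℤ
  ... | suc (suc _) = j

  IsSimple : Perm → Set
  IsSimple p = Σ ℕ λ i → (1 ℕ.≤ i) × (i ℕ.≤ n) × (∀ j → fun p j ≡ sfun (+ i) j)

  IsRefl : Perm → Set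
  IsRefl r = Σ Perm λ w → Σ Perm λ s → InW w × IsSimple s × (r ≈ conj w s)

  IsCoxeterLength : (Perm → ℕ) → Set
  IsCoxeterLength ℓ = ∀ w → InW w →
      (Σ (List Perm) λ ws → All IsSimple ws × (length ws ≡ ℓ w) × (prod ws ≈ w))
    × (∀ ws → All IsSimple ws → prod ws ≈ w → ℓ w ℕ.≤ length ws)

  InFPF : Perm → Set
  InFPF z = InW z × (∀ i → fun z (fun z i) ≡ i) × (∀ i → ¬ (fun z i ≡ i))

  htFPF : (Perm → ℕ) → Perm → ℤ
  htFPF ℓ z = (+ ℓ z - + (n ℕ./ 2)) /ℕ 2

  record IsWSet (InX : Perm → Set) (act : Perm → Perm → Perm) : Set where
    field
      closed  : ∀ w x → InW w → InX x → InX (act w x)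
      act-id  : ∀ x → InX x → act idPerm x ≈ x
      act-∘   : ∀ v w x → InW v → InW w → InX x → act (v ∘ₚ w) x ≈ act v (act w x)
      act-resp : ∀ w w′ x x′ → InW w → InX x → w ≈ w′ → x ≈ x′ → act w x ≈ act w′ x′

  record IsQuasiparabolic (InX : Perm → Set) (act : Perm → Perm → Perm) (ht : Perm → ℤ) : Set where
    field
      wset    : IsWSet InX act
      ht-resp : ∀ x x′ → InX x → x ≈ x′ → ht x ≡ ht x′
      scaled  : ∀ s x → IsSimple s → InX x → ∣ ht (act s x) - ht x ∣ ℕ.≤ 1
      QP1     : ∀ r x → IsRefl r → InX x → ht (act r x) ≡ ht x → act r x ≈ x
      QP2     : ∀ r x s → IsRefl r → InX x → IsSimple s →
                ht x < ht (act r x) → ht (act s (act r x)) < ht (act s x) →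
                act r x ≈ act s x

{-# OPTIONS --safe #-}
module Submission where

-- Let r = t_{ab} with a < b, and let x be a fixed-point-free involution.  The
-- whole proof rests on the claim that ht(rxr) is smaller than, equal to or larger
-- than ht(x) according to how rxr(a) compares with x(a), equality meaning rxr = x.
-- The claim goes by induction on ℓ(x): x has a simple descent s unless
-- x(i) = i ± 1 for all i, in which case nothing can decrease it, and conjugating
-- r and x by s preserves the comparison unless s = r or s inverts the pair x(a), rxr(a).
-- In the latter case s = xrx commutes with r, so rxr = sxs.  QP1 is the case of
-- equality, and QP2 is one more use of the same alternative.  That a simple
-- descent lowers ℓ by exactly 2 is the exchange property, applied on both sides.

open import Defs
open import Data.Nat using (ℕ; _≤_)
open import Data.Nat.Divisibility using (_∣_)

open import Data.Nat using (zero; suc; z≤n; s≤s)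
import Data.Nat as ℕ
import Data.Nat.Properties as ℕₚ
open import Data.Integer as ℤ using (ℤ; +_; -[1+_]; _+_; _-_; _*_; -_; ∣_∣; 0ℤ; 1ℤ; -1ℤ; +≤+; +<+)
  renaming (_≤_ to _≤ᶻ_; _<_ to _<ᶻ_)
import Data.Integer.Properties as ℤₚ
open import Data.Integer.DivMod using (_%ℕ_; _/ℕ_; n%ℕd<d; a≡a%ℕn+[a/ℕn]*n; n<s[n/ℕd]*d; [n/ℕd]*d≤n)
open import Algebra.Properties.AbelianGroup ℤₚ.+-0-abelianGroup using (∙-cancelʳ)
open import Data.Integer.Tactic.RingSolver using (solve-∀)
open import Data.List using (List; []; _∷_; length; _++_)
open import Data.List.Properties using (length-++)
open import Data.List.Relation.Unary.All using (All; []; _∷_)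
open import Data.List.Relation.Unary.All.Properties using (++⁺)
open import Data.Product using (∃; _×_; _,_; proj₁; proj₂)
open import Data.Sum using (_⊎_; inj₁; inj₂)
open import Induction.WellFounded using (Acc; acc)
open import Data.Nat.Induction using (<-wellFounded)
open import Data.Empty using (⊥; ⊥-elim)
open import Relation.Nullary using (¬_; Dec; yes; no)
open import Relation.Binary.Definitions using (tri<; tri≈; tri>)
open import Relation.Binary.PropositionalEquality

-- Linear inequalities are settled by certificates: gap≤ and gap< turn hypotheses
-- into non-negative terms, _⊕_ adds them up, and the ring solver identifies the sum.
gap≤ : ∀ {a b} → a ≤ᶻ b → 0ℤ ≤ᶻ b - a
gap≤ = ℤₚ.i≤j⇒0≤j-i

gap< : ∀ {a b} → a <ᶻ b → 0ℤ ≤ᶻ b - (1ℤ + a)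
gap< a<b = gap≤ (ℤₚ.i<j⇒suc[i]≤j a<b)

infixl 6 _⊕_
_⊕_ : ∀ {a b} → 0ℤ ≤ᶻ a → 0ℤ ≤ᶻ b → 0ℤ ≤ᶻ a + b
_⊕_ = ℤₚ.+-mono-≤

by≤ : ∀ {a b e} → 0ℤ ≤ᶻ e → e ≡ b - a → a ≤ᶻ b
by≤ 0≤e eq = ℤₚ.0≤i-j⇒j≤i (subst (0ℤ ≤ᶻ_) eq 0≤e)

distance-≤1 : ∀ {a b} → a ≤ᶻ b + 1ℤ → b ≤ᶻ a + 1ℤ → ∣ a - b ∣ ≤ 1
distance-≤1 {a} {b} a≤b+1 b≤a+1 = bound (a - b)
    (by≤ (gap≤ a≤b+1) (e₁ a b)) (by≤ (gap≤ b≤a+1) (e₂ a b))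
  where
  e₁ : ∀ a b → b + 1ℤ - a ≡ 1ℤ - (a - b)
  e₁ = solve-∀
  e₂ : ∀ a b → a + 1ℤ - b ≡ a - b - -1ℤ
  e₂ = solve-∀
  bound : ∀ z → z ≤ᶻ 1ℤ → -1ℤ ≤ᶻ z → ∣ z ∣ ≤ 1
  bound (+ _)    (+≤+ m≤1) _ = m≤1
  bound -[1+ _ ] _ (ℤ.-≤- m≤0) = s≤s m≤0

by⊥ : ∀ {e} → 0ℤ ≤ᶻ e → e ≡ -1ℤ → ⊥
by⊥ () refl

≤-suc⇒< : ∀ {a b} → a + 1ℤ ≤ᶻ b → a <ᶻ b
≤-suc⇒< {a} a+1≤b = ℤₚ.suc[i]≤j⇒i<j (subst (_≤ᶻ _) (ℤₚ.+-comm a 1ℤ) a+1≤b)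

<⇒suc-≤ : ∀ {a b} → a <ᶻ b → a + 1ℤ ≤ᶻ b
<⇒suc-≤ {a} a<b = subst (_≤ᶻ _) (ℤₚ.+-comm 1ℤ a) (ℤₚ.i<j⇒suc[i]≤j a<b)

<-suc⇒≤ : ∀ {a b} → a <ᶻ b + 1ℤ → a ≤ᶻ b
<-suc⇒≤ {a} {b} a<b+1 = by≤ (gap< a<b+1) (eq a b)
  where
  eq : ∀ a b → (b + 1ℤ) - (1ℤ + a) ≡ b - a
  eq = solve-∀

n<n+1 : ∀ a → a <ᶻ a + 1ℤ
n<n+1 a = ≤-suc⇒< ℤₚ.≤-refl

-- The two equations add up to `z + z ≡ 0ℤ`, so `z` vanishes. This is what keeps an involution
-- commuting with translations from sending a point to a proper translate of itself.
mutual-shift⇒≡ : ∀ {x y} z → x ≡ y + z → y ≡ x + z → x ≡ y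
mutual-shift⇒≡ {x} {y} z x≡y+z y≡x+z = trans x≡y+z (trans (cong (_+_ y) z≡0) (ℤₚ.+-identityʳ y))
  where
  eq : ∀ x y z → z + z ≡ (x + z) - y + ((y + z) - x)
  eq = solve-∀
  eq′ : ∀ x y → y - y + (x - x) ≡ 0ℤ
  eq′ = solve-∀
  double : ∀ w → w + w ≡ 0ℤ → w ≡ 0ℤ
  double (+ zero) _ = refl
  z≡0 : z ≡ 0ℤ
  z≡0 = double z (trans (eq x y z)
    (trans (cong₂ (λ u v → u - y + (v - x)) (sym y≡x+z) (sym x≡y+z)) (eq′ x y)))

-- Permutations and conjugation

fun-injective : ∀ w {c d} → fun w c ≡ fun w d → c ≡ d
fun-injective w {c} {d} eq = trans (sym (inv∘fun w c)) (trans (cong (inv w) eq) (inv∘fun w d))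

involution-inv : ∀ r → (∀ c → fun r (fun r c) ≡ c) → ∀ c → inv r c ≡ fun r c
involution-inv r rr c = trans (cong (inv r) (sym (rr c))) (inv∘fun r (fun r c))

conj-resp-≈ : ∀ v w x y → v ≈ w → x ≈ y → conj v x ≈ conj w y
conj-resp-≈ v w x y v≈w x≈y i =
  trans (v≈w _) (cong (fun w) (trans (x≈y _) (cong (fun y) inv≗)))
  where
  inv≗ : inv v i ≡ inv w i
  inv≗ = trans (cong (inv v) (trans (sym (fun∘inv w i)) (sym (v≈w (inv w i))))) (inv∘fun v (inv w i))

conj-conj : ∀ s r x → conj s (conj r x) ≈ conj (conj s r) (conj s x)
conj-conj s r x i = cong (λ j → fun s (fun r j)) (sym (trans (inv∘fun s _)
  (cong (fun x) (inv∘fun s _))))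

conj-image : ∀ s x a → fun (conj s x) (fun s a) ≡ fun s (fun x a)
conj-image s x a = cong (λ u → fun s (fun x u)) (inv∘fun s a)

-- Division with remainder

private
  quotient-≮ : ∀ {d r r′ : ℕ} {q q′ : ℤ} → r ℕ.< d →
    + r + q * + d ≡ + r′ + q′ * + d → ¬ (q <ᶻ q′)
  quotient-≮ {d} {r} {r′} {q} {q′} r<d eq q<q′ =
    by⊥ (gap≤ qd≤ ⊕ gap≤ (+≤+ {0} {r′} z≤n) ⊕ gap< (+<+ r<d))
      (trans (e₁ (+ r) (+ r′) q q′ (+ d)) (trans (cong (λ u → u - (+ r + q * + d) - 1ℤ) (sym eq)) (e₂ (+ r + q * + d))))
    where
    qd≤ : (1ℤ + q) * + d ≤ᶻ q′ * + d
    qd≤ = ℤₚ.*-monoʳ-≤-nonNeg (+ d) (ℤₚ.i<j⇒suc[i]≤j q<q′)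
    e₁ : ∀ r r′ q q′ d → (q′ * d - (1ℤ + q) * d) + (r′ - 0ℤ) + (d - (1ℤ + r)) ≡ (r′ + q′ * d) - (r + q * d) - 1ℤ
    e₁ = solve-∀
    e₂ : ∀ u → u - u - 1ℤ ≡ -1ℤ
    e₂ = solve-∀

divMod-unique : ∀ {d r r′ : ℕ} (q q′ : ℤ) → r ℕ.< d → r′ ℕ.< d →
  + r + q * + d ≡ + r′ + q′ * + d → r ≡ r′ × q ≡ q′
divMod-unique {d} {r} {r′} q q′ r<d r′<d eq with ℤₚ.<-cmp q q′
... | tri< q<q′ _ _ = ⊥-elim (quotient-≮ {q = q} {q′} r<d eq q<q′)
... | tri> _ _ q′<q = ⊥-elim (quotient-≮ {q = q′} {q} r′<d (sym eq) q′<q)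
... | tri≈ _ refl _ = ℤₚ.+-injective (∙-cancelʳ (q * + d) (+ r) (+ r′) eq) , refl

%ℕ-unique : ∀ d .{{_ : ℕ.NonZero d}} {r} q → r ℕ.< d → (+ r + q * + d) %ℕ d ≡ r
%ℕ-unique d {r} q r<d = proj₁ (divMod-unique (a /ℕ d) q (n%ℕd<d a d) r<d (sym (a≡a%ℕn+[a/ℕn]*n a d)))
  where a = + r + q * + d

-- If the quotient of `u` were larger, `u` would be at least `(v /ℕ d + 1) * d`, which already
-- exceeds `v`.
/ℕ-mono : ∀ d .{{_ : ℕ.NonZero d}} {u v} → u ≤ᶻ v → u /ℕ d ≤ᶻ v /ℕ d
/ℕ-mono d {u} {v} u≤v with (u /ℕ d) ℤ.≤? (v /ℕ d)
... | yes p = p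
... | no ¬p = ⊥-elim (ℤₚ.<-irrefl refl (ℤₚ.<-≤-trans (n<s[n/ℕd]*d v d)
  (ℤₚ.≤-trans (ℤₚ.*-monoʳ-≤-nonNeg (+ d) (ℤₚ.i<j⇒suc[i]≤j (ℤₚ.≰⇒> ¬p)))
    (ℤₚ.≤-trans ([n/ℕd]*d≤n u d) u≤v))))

/ℕ-shift : ∀ d .{{_ : ℕ.NonZero d}} u → (u + + d) /ℕ d ≡ u /ℕ d + 1ℤ
/ℕ-shift d u = proj₂ (divMod-unique ((u + + d) /ℕ d) (u /ℕ d + 1ℤ) (n%ℕd<d (u + + d) d) (n%ℕd<d u d)
  (trans (sym (a≡a%ℕn+[a/ℕn]*n (u + + d) d))
    (trans (cong (_+ + d) (a≡a%ℕn+[a/ℕn]*n u d)) (eq (+ (u %ℕ d)) (u /ℕ d) (+ d)))))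
  where
  eq : ∀ r q d → r + q * d + d ≡ r + (q + 1ℤ) * d
  eq = solve-∀

-- Reflections and crossings

module Periodicity (N : ℤ) where

  infix 4 _∼_
  -- Congruence modulo `N` with the quotient kept, so that matching on `multiple m refl` replaces
  -- `c` by `a + m * N`.
  data _∼_ (c a : ℤ) : Set where
    multiple : ∀ m → c ≡ a + m * N → c ∼ a

  Periodic : (ℤ → ℤ) → Set
  Periodic f = ∀ i → f (i + N) ≡ f i + N

  ∼-sym : ∀ {a b} → a ∼ b → b ∼ a
  ∼-sym {b = b} (multiple m refl) = multiple (- m) (eq b m N)
    where
    eq : ∀ b m N → b ≡ b + m * N + - m * N
    eq = solve-∀

  ∼-trans : ∀ {a b c} → a ∼ b → b ∼ c → a ∼ c
  ∼-trans {c = c} (multiple m refl) (multiple m′ refl) = multiple (m′ + m) (eq c m m′ N)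
    where
    eq : ∀ c m m′ N → c + m′ * N + m * N ≡ c + (m′ + m) * N
    eq = solve-∀

  periodic-∘ : ∀ f g → Periodic f → Periodic g → Periodic (λ i → f (g i))
  periodic-∘ f g pf pg i = trans (cong f (pg i)) (pf (g i))

  periodic-≗ : ∀ {f g} → (∀ i → f i ≡ g i) → Periodic f → Periodic g
  periodic-≗ f≗g pf i = trans (sym (f≗g (i + N))) (trans (pf i) (cong (_+ N) (f≗g i)))

  periodic-inv : ∀ w → Periodic (fun w) → Periodic (inv w)
  periodic-inv w pw i = trans (cong (λ j → inv w (j + N)) (sym (fun∘inv w i)))
    (trans (cong (inv w) (sym (pw (inv w i)))) (inv∘fun w (inv w i + N)))

  private
    shift⁺ : ∀ f → Periodic f → ∀ i m → f (i + + m * N) ≡ f i + + m * N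
    shift⁺ f pf i zero = trans (cong f (ℤₚ.+-identityʳ i)) (sym (ℤₚ.+-identityʳ (f i)))
    shift⁺ f pf i (suc m) = trans (cong f (eq i (+ m) N))
        (trans (pf (i + + m * N)) (trans (cong (_+ N) (shift⁺ f pf i m)) (sym (eq (f i) (+ m) N))))
      where
      eq : ∀ i m N → i + (1ℤ + m) * N ≡ i + m * N + N
      eq = solve-∀

  shift : ∀ f → Periodic f → ∀ i m → f (i + m * N) ≡ f i + m * N
  shift f pf i (+ m) = shift⁺ f pf i m
  shift f pf i -[1+ m ] = trans (e₁ (f (i + - M * N)) M N)
      (cong (_+ - M * N) (trans (sym (shift⁺ f pf (i + - M * N) (suc m))) (cong f (sym (e₂ i M N)))))
    where
    M = + suc m
    e₁ : ∀ u M N → u ≡ u + M * N + - M * N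
    e₁ = solve-∀
    e₂ : ∀ i M N → i ≡ i + - M * N + M * N
    e₂ = solve-∀

  -- The paper's reflection t_{ab}, without requiring a < b.
  record Swap (a b : ℤ) (r : Perm) : Set where
    field
      periodic  : Periodic (fun r)
      a↦b       : fun r a ≡ b
      b↦a       : fun r b ≡ a
      elsewhere : ∀ c → c ∼ a ⊎ c ∼ b ⊎ fun r c ≡ c

    a↦b+ : ∀ m → fun r (a + m * N) ≡ b + m * N
    a↦b+ m = trans (shift (fun r) periodic a m) (cong (_+ m * N) a↦b)

    b↦a+ : ∀ m → fun r (b + m * N) ≡ a + m * N
    b↦a+ m = trans (shift (fun r) periodic b m) (cong (_+ m * N) b↦a)

    involutive : ∀ c → fun r (fun r c) ≡ c
    involutive c with elsewhere c
    ... | inj₁ (multiple m refl)        = trans (cong (fun r) (a↦b+ m)) (b↦a+ m)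
    ... | inj₂ (inj₁ (multiple m refl)) = trans (cong (fun r) (b↦a+ m)) (a↦b+ m)
    ... | inj₂ (inj₂ rc≡c)              = trans (cong (fun r) rc≡c) rc≡c

    inv≗fun : ∀ c → inv r c ≡ fun r c
    inv≗fun = involution-inv r involutive

    fixes : ∀ {c} → ¬ (c ∼ a) → ¬ (c ∼ b) → fun r c ≡ c
    fixes {c} c≁a c≁b with elsewhere c
    ... | inj₁ c∼a         = ⊥-elim (c≁a c∼a)
    ... | inj₂ (inj₁ c∼b)  = ⊥-elim (c≁b c∼b)
    ... | inj₂ (inj₂ rc≡c) = rc≡c

    -- If `a` is `b + m * N`, then `r` sends it to `a + m * N` as well as to `b`; the two equations
    -- together force `m * N` to vanish.
    disjoint : a ≢ b → ¬ (a ∼ b)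
    disjoint a≢b (multiple m a≡b+mN) = a≢b (mutual-shift⇒≡ (m * N) a≡b+mN
      (trans (sym a↦b) (trans (cong (fun r) a≡b+mN) (b↦a+ m))))

  open Swap

  swap-sym : ∀ {a b r} → Swap a b r → Swap b a r
  swap-sym S = record
    { periodic = periodic S ; a↦b = b↦a S ; b↦a = a↦b S
    ; elsewhere = λ c → rotate (elsewhere S c) }
    where
    rotate : ∀ {A B C : Set} → A ⊎ B ⊎ C → B ⊎ A ⊎ C
    rotate (inj₁ x)        = inj₂ (inj₁ x)
    rotate (inj₂ (inj₁ x)) = inj₁ x
    rotate (inj₂ (inj₂ x)) = inj₂ (inj₂ x)

  swap-resp-≈ : ∀ {a b r t} → r ≈ t → Swap a b r → Swap a b t
  swap-resp-≈ {a} {b} {r} {t} r≈t S = record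
    { periodic = periodic-≗ r≈t (periodic S)
    ; a↦b = trans (sym (r≈t a)) (a↦b S) ; b↦a = trans (sym (r≈t b)) (b↦a S)
    ; elsewhere = elsewhere′ }
    where
    elsewhere′ : ∀ c → c ∼ a ⊎ c ∼ b ⊎ fun t c ≡ c
    elsewhere′ c with elsewhere S c
    ... | inj₁ x        = inj₁ x
    ... | inj₂ (inj₁ x) = inj₂ (inj₁ x)
    ... | inj₂ (inj₂ x) = inj₂ (inj₂ (trans (sym (r≈t c)) x))

  -- The device by which reflections are recognised as equal: one exchanged pair suffices. The
  -- alternatives of `elsewhere` may overlap, so the two swaps can classify `c` differently and the
  -- mixed cases have to be treated.
  swap-unique : ∀ {a b r t} → Swap a b r → Swap a b t → r ≈ t
  swap-unique S T c with elsewhere S c | elsewhere T c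
  ... | inj₁ (multiple m refl)        | _                             = trans (a↦b+ S m) (sym (a↦b+ T m))
  ... | inj₂ (inj₁ (multiple m refl)) | _                             = trans (b↦a+ S m) (sym (b↦a+ T m))
  ... | inj₂ (inj₂ _)                 | inj₁ (multiple m refl)        = trans (a↦b+ S m) (sym (a↦b+ T m))
  ... | inj₂ (inj₂ _)                 | inj₂ (inj₁ (multiple m refl)) = trans (b↦a+ S m) (sym (b↦a+ T m))
  ... | inj₂ (inj₂ rc≡c)              | inj₂ (inj₂ tc≡c)              = trans rc≡c (sym tc≡c)

  swap-conj : ∀ {a b r} w → Periodic (fun w) → Swap a b r → Swap (fun w a) (fun w b) (conj w r)
  swap-conj {a} {b} {r} w pw S = record
    { periodic = periodic-∘ (fun w) (fun (r ∘ₚ (w ⁻¹))) pw (periodic-∘ (fun r) (inv w) (periodic S) (periodic-inv w pw))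
    ; a↦b = cong (fun w) (trans (cong (fun r) (inv∘fun w a)) (a↦b S))
    ; b↦a = cong (fun w) (trans (cong (fun r) (inv∘fun w b)) (b↦a S))
    ; elsewhere = elsewhere′ }
    where
    transport : ∀ {c d} → inv w c ∼ d → c ∼ fun w d
    transport {c} {d} (multiple m eq) = multiple m (trans (sym (fun∘inv w c)) (trans (cong (fun w) eq) (shift (fun w) pw d m)))
    elsewhere′ : ∀ c → c ∼ fun w a ⊎ c ∼ fun w b ⊎ fun (conj w r) c ≡ c
    elsewhere′ c with elsewhere S (inv w c)
    ... | inj₁ x        = inj₁ (transport x)
    ... | inj₂ (inj₁ x) = inj₂ (inj₁ (transport x))
    ... | inj₂ (inj₂ x) = inj₂ (inj₂ (trans (cong (fun w) x) (fun∘inv w c)))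

  private
    swap-shift : ∀ {a b r p} → Swap a b r → p ∼ a → Swap p (fun r p) r
    swap-shift {r = r} {p} S p∼a@(multiple m refl) = record
      { periodic = periodic S ; a↦b = refl ; b↦a = involutive S p ; elsewhere = elsewhere′ }
      where
      elsewhere′ : ∀ c → c ∼ p ⊎ c ∼ fun r p ⊎ fun r c ≡ c
      elsewhere′ c with elsewhere S c
      ... | inj₁ x        = inj₁ (∼-trans x (∼-sym p∼a))
      ... | inj₂ (inj₁ x) = inj₂ (inj₁ (∼-trans x (∼-sym (multiple m (a↦b+ S m)))))
      ... | inj₂ (inj₂ x) = inj₂ (inj₂ x)

  swap-moved : ∀ {a b r p} → Swap a b r → fun r p ≢ p → Swap p (fun r p) r
  swap-moved {p = p} S rp≢p with elsewhere S p
  ... | inj₁ p∼a         = swap-shift S p∼a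
  ... | inj₂ (inj₁ p∼b)  = swap-shift (swap-sym S) p∼b
  ... | inj₂ (inj₂ rp≡p) = ⊥-elim (rp≢p rp≡p)

  -- Since `s` fixes `a` and `b`, the conjugate of `r` by `s` exchanges the same pair as `r`, hence
  -- equals `r`.
  swap-commute : ∀ {a b c d r s} → Swap a b r → Swap c d s →
    ¬ (a ∼ c) → ¬ (a ∼ d) → ¬ (b ∼ c) → ¬ (b ∼ d) → ∀ j → fun s (fun r j) ≡ fun r (fun s j)
  swap-commute {a} {b} {r = r} {s} R S a≁c a≁d b≁c b≁d j =
    trans (cong (λ i → fun s (fun r i)) (sym (inv∘fun s j))) (swap-unique srs R (fun s j))
    where
    srs : Swap a b (conj s r)
    srs = subst₂ (λ u v → Swap u v (conj s r)) (fixes S a≁c a≁d) (fixes S b≁c b≁d) (swap-conj s (periodic S) R)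

  -- Simple reflections and the pairs they invert

  Simple : Perm → Set
  Simple s = ∃ λ i → Swap i (i + 1ℤ) s

  simple-step : ∀ {s} → Simple s → ∀ j → fun s j ≡ j ⊎ fun s j ≡ j + 1ℤ ⊎ fun s j ≡ j - 1ℤ
  simple-step (i , S) j with elsewhere S j
  ... | inj₁ (multiple m refl) = inj₂ (inj₁ (trans (a↦b+ S m) (eq i m N)))
    where
    eq : ∀ i m N → i + 1ℤ + m * N ≡ i + m * N + 1ℤ
    eq = solve-∀
  ... | inj₂ (inj₁ (multiple m refl)) = inj₂ (inj₂ (trans (b↦a+ S m) (eq i m N)))
    where
    eq : ∀ i m N → i + m * N ≡ i + 1ℤ + m * N - 1ℤ
    eq = solve-∀
  ... | inj₂ (inj₂ sj≡j) = inj₁ sj≡j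

  private
    simple-≥ : ∀ {s} → Simple s → ∀ j → j ≤ᶻ fun s j + 1ℤ
    simple-≥ {s} S j with simple-step S j
    ... | inj₁ eq        = subst (λ u → j ≤ᶻ u + 1ℤ) (sym eq) (ℤₚ.<⇒≤ (n<n+1 j))
    ... | inj₂ (inj₁ eq) = subst (λ u → j ≤ᶻ u + 1ℤ) (sym eq) (ℤₚ.<⇒≤ (ℤₚ.<-trans (n<n+1 j) (n<n+1 (j + 1ℤ))))
    ... | inj₂ (inj₂ eq) = subst (λ u → j ≤ᶻ u + 1ℤ) (sym eq) (ℤₚ.≤-reflexive (e j))
      where
      e : ∀ j → j ≡ j - 1ℤ + 1ℤ
      e = solve-∀

  -- No integer moves by more than 1 under `s`. Reversing `p <ᶻ q` therefore requires `p` to go up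
  -- by one, and then `q` can only be its neighbour.
  inverted-by-simple : ∀ {s p q} → Simple s → p <ᶻ q → fun s q <ᶻ fun s p → q ≡ p + 1ℤ × Swap p q s
  inverted-by-simple {s} {p} {q} S p<q sq<sp with simple-step S p
  ... | inj₁ sp≡p = ⊥-elim (by⊥
        (gap< p<q ⊕ gap≤ (simple-≥ S q) ⊕ gap< (subst (fun s q <ᶻ_) sp≡p sq<sp))
        (e p q (fun s q)))
    where
    e : ∀ p q z → q - (1ℤ + p) + (z + 1ℤ - q) + (p - (1ℤ + z)) ≡ -1ℤ
    e = solve-∀
  ... | inj₂ (inj₂ sp≡p-1) = ⊥-elim (by⊥
        (gap< p<q ⊕ gap≤ (simple-≥ S q) ⊕ gap< (subst (fun s q <ᶻ_) sp≡p-1 sq<sp) ⊕ +≤+ {0} {1} z≤n)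
        (e p q (fun s q)))
    where
    e : ∀ p q z → q - (1ℤ + p) + (z + 1ℤ - q) + (p - 1ℤ - (1ℤ + z)) + 1ℤ ≡ -1ℤ
    e = solve-∀
  ... | inj₂ (inj₁ sp≡p+1) = q≡p+1 , subst (λ u → Swap p u s) (trans sp≡p+1 (sym q≡p+1)) (swap-moved (proj₂ S) moved)
    where
    q≡p+1 : q ≡ p + 1ℤ
    q≡p+1 = ℤₚ.≤-antisym
      (ℤₚ.≤-trans (simple-≥ S q) (ℤₚ.+-monoˡ-≤ 1ℤ (<-suc⇒≤ {b = p} (subst (fun s q <ᶻ_) sp≡p+1 sq<sp))))
      (<⇒suc-≤ p<q)
    moved : fun s p ≢ p
    moved sp≡p = ℤₚ.<-irrefl (trans (sym sp≡p) sp≡p+1) (n<n+1 p)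

  conj-at : ∀ {a b r} → Swap a b r → ∀ x → fun (conj r x) a ≡ fun r (fun x b)
  conj-at {a} {r = r} R x = cong (λ i → fun r (fun x i)) (trans (inv≗fun R a) (a↦b R))

  conj-involutive : ∀ {a b r} → Swap a b r → ∀ x → conj r (conj r x) ≈ x
  conj-involutive {r = r} R x j = trans (involutive R _) (cong (fun x)
    (trans (cong (inv r) (inv≗fun R j)) (inv∘fun r j)))

  -- Fixed-point-free involutions and their descents

  module FixedPointFree (x : Perm) (px : Periodic (fun x))
    (xx : ∀ i → fun x (fun x i) ≡ i) (x≢ : ∀ i → ¬ (fun x i ≡ i)) where

    image-≁ : ∀ c → ¬ (fun x c ∼ c)
    image-≁ c (multiple m eq) = x≢ c (mutual-shift⇒≡ (m * N) eq
      (trans (sym (xx c)) (trans (cong (fun x) eq) (shift (fun x) px c m))))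

    image-∼ : ∀ {c d} → fun x c ∼ d → fun x d ∼ c
    image-∼ {c} {d} (multiple m eq) = ∼-sym (multiple m
      (trans (sym (xx c)) (trans (cong (fun x) eq) (shift (fun x) px d m))))

    -- If s swaps x(a) with rxr(a), then b is not congruent to x(a), so s = xrx has
    -- support disjoint from that of r and commutes with it.
    conj-agree : ∀ {a b r s} → Swap a b r → Swap (fun x a) (fun (conj r x) a) s →
      fun x a ≢ fun (conj r x) a → conj r x ≈ conj s x
    conj-agree {a} {b} {r} {s} R S xa≢ = agree
      where
      ya≡rxb : fun (conj r x) a ≡ fun r (fun x b)
      ya≡rxb = conj-at R x
      -- Otherwise x(b) is congruent to a, so rxr(a) = r(x(b)) is congruent to b and hence to x(a),
      -- whereas the classes swapped by `s` are distinct.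
      xa≁b : ¬ (fun x a ∼ b)
      xa≁b xa∼b = disjoint S xa≢ (∼-trans xa∼b (∼-sym ya∼b))
        where
        ya∼b : fun (conj r x) a ∼ b
        ya∼b with image-∼ xa∼b
        ... | multiple m eq = multiple m (trans ya≡rxb (trans (cong (fun r) eq) (a↦b+ R m)))
      xb≁a : ¬ (fun x b ∼ a)
      xb≁a xb∼a = xa≁b (image-∼ xb∼a)
      ya≡xb : fun (conj r x) a ≡ fun x b
      ya≡xb = trans ya≡rxb (fixes R xb≁a (image-≁ b))
      S′ : Swap (fun x a) (fun x b) s
      S′ = subst (λ u → Swap (fun x a) u s) ya≡xb S
      s≗xrx : ∀ j → fun s j ≡ fun x (fun r (fun x j))
      s≗xrx j = trans (swap-unique S′ (swap-conj x px R) j)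
        (cong (λ i → fun x (fun r i)) (involution-inv x xx j))
      rs≗sr : ∀ j → fun s (fun r j) ≡ fun r (fun s j)
      rs≗sr = swap-commute R S′ (λ a∼xa → image-≁ a (∼-sym a∼xa)) (λ a∼xb → xb≁a (∼-sym a∼xb))
        (λ b∼xa → xa≁b (∼-sym b∼xa)) (λ b∼xb → image-≁ b (∼-sym b∼xb))
      agree : conj r x ≈ conj s x
      agree j = sym (begin
        fun s (fun x (inv s j))                 ≡⟨ cong (λ i → fun s (fun x i)) (inv≗fun S j) ⟩
        fun s (fun x (fun s j))                 ≡⟨ cong (λ i → fun s (fun x i)) (s≗xrx j) ⟩
        fun s (fun x (fun x (fun r (fun x j)))) ≡⟨ cong (fun s) (xx _) ⟩
        fun s (fun r (fun x j))                 ≡⟨ rs≗sr (fun x j) ⟩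
        fun r (fun s (fun x j))                 ≡⟨ cong (fun r) (s≗xrx (fun x j)) ⟩
        fun r (fun x (fun r (fun x (fun x j)))) ≡⟨ cong (λ i → fun r (fun x (fun r i))) (xx j) ⟩
        fun r (fun x (fun r j))                 ≡⟨ cong (λ i → fun r (fun x i)) (sym (inv≗fun R j)) ⟩
        fun r (fun x (inv r j))                 ∎)
        where open ≡-Reasoning

    -- Applying r to the hypothesis gives r(x(a)) = x(b). So `r` and its conjugate by `x` exchange
    -- the same pair and coincide: `x` commutes with `r`.
    conj-fixes : ∀ {a b r} → Swap a b r → a ≢ b → fun (conj r x) a ≡ fun x a → conj r x ≈ x
    conj-fixes {a} {b} {r} R a≢b ya≡xa j = begin
      fun r (fun x (inv r j))                 ≡⟨ cong (λ i → fun r (fun x i)) (inv≗fun R j) ⟩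
      fun r (fun x (fun r j))                 ≡⟨ cong (fun r) (xr≗rx j) ⟩
      fun r (fun r (fun x j))                 ≡⟨ involutive R (fun x j) ⟩
      fun x j                                 ∎
      where
      open ≡-Reasoning
      rxa≡xb : fun r (fun x a) ≡ fun x b
      rxa≡xb = trans (cong (fun r) (trans (sym ya≡xa) (conj-at R x))) (involutive R (fun x b))
      R′ : Swap (fun x a) (fun x b) r
      R′ = subst (λ u → Swap (fun x a) u r) rxa≡xb
        (swap-moved R (λ eq → a≢b (fun-injective x (trans (sym eq) rxa≡xb))))
      xr≗rx : ∀ i → fun x (fun r i) ≡ fun r (fun x i)
      xr≗rx i = trans (cong (λ k → fun x (fun r k)) (sym (inv∘fun x i)))
        (swap-unique (swap-conj x px R) R′ (fun x i))

    -- The second condition excludes exactly the i for which s_i fixes x under conjugation.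
    Descent : ℤ → Set
    Descent i = fun x (i + 1ℤ) <ᶻ fun x i × fun x i ≢ i + 1ℤ

    descent? : ∀ i → Dec (Descent i)
    descent? i with fun x (i + 1ℤ) ℤ.<? fun x i | fun x i ℤ.≟ i + 1ℤ
    ... | yes lt | no neq = yes (lt , neq)
    ... | no ¬lt | _      = no λ d → ¬lt (proj₁ d)
    ... | _      | yes eq = no λ d → proj₂ d eq

    descent-shift : ∀ {i j} → i ∼ j → Descent i → Descent j
    descent-shift {i} {j} i∼j (lt , neq) with ∼-sym i∼j
    ... | multiple m refl =
        subst₂ _<ᶻ_ (sym (trans (cong (fun x) (eq i m N)) (shift (fun x) px _ m))) (sym (shift (fun x) px i m)) (ℤₚ.+-monoˡ-< (m * N) lt)
      , λ xj≡ → neq (∙-cancelʳ (m * N) _ _ (trans (sym (shift (fun x) px i m)) (trans xj≡ (eq i m N))))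
      where
      eq : ∀ i m N → i + m * N + 1ℤ ≡ i + 1ℤ + m * N
      eq = solve-∀

    -- Makes a second exchange possible, on the other side of x. If `s` reversed the pair, its
    -- members would be neighbours swapped by `s`, so x(i) would be congruent to i or i + 1. The
    -- former contradicts fixed-point-freeness; the latter forces x(i) = i + 1, which `Descent`
    -- excludes.
    descent-persists : ∀ {i s} → Swap i (i + 1ℤ) s → Descent i → fun s (fun x (i + 1ℤ)) <ᶻ fun s (fun x i)
    descent-persists {i} {s} S (lt , neq) with ℤₚ.<-cmp (fun s (fun x (i + 1ℤ))) (fun s (fun x i))
    ... | tri< p _ _ = p
    ... | tri≈ _ p _ = ⊥-elim (ℤₚ.<-irrefl (fun-injective s p) lt)
    ... | tri> _ _ p with inverted-by-simple (i , S) lt p | elsewhere S (fun x i)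
    ... | _ , _     | inj₁ xi∼i         = ⊥-elim (image-≁ i xi∼i)
    ... | _ , S′    | inj₂ (inj₂ sxi≡xi) = ⊥-elim (ℤₚ.<-irrefl (trans (sym (b↦a S′)) sxi≡xi) lt)
    ... | xi≡ , _   | inj₂ (inj₁ (multiple m eq)) = ⊥-elim (neq (trans xi≡ (cong (_+ 1ℤ) (sym i≡u))))
      where
      u = fun x (i + 1ℤ)
      +-swap : ∀ i z → i + 1ℤ + z ≡ i + z + 1ℤ
      +-swap = solve-∀
      i≡u : i ≡ u
      i≡u = mutual-shift⇒≡ (m * N)
        (trans (sym (xx i)) (trans (cong (fun x) eq) (shift (fun x) px _ m)))
        (∙-cancelʳ 1ℤ _ _ (trans (sym xi≡) (trans eq (+-swap i (m * N)))))

    -- Involutions without descents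

    module WithoutDescents (no-descent : ∀ i → ¬ Descent i) where

      private
        ascent : ∀ i → fun x i <ᶻ fun x (i + 1ℤ) ⊎ fun x i ≡ i + 1ℤ
        ascent i with fun x i ℤ.≟ i + 1ℤ | ℤₚ.<-cmp (fun x i) (fun x (i + 1ℤ))
        ... | yes eq | _          = inj₂ eq
        ... | no neq | tri< p _ _ = inj₁ p
        ... | no neq | tri> _ _ p = ⊥-elim (no-descent i (p , neq))
        ... | no neq | tri≈ _ p _ = ⊥-elim (ℤₚ.<-irrefl
              (fun-injective x p) (n<n+1 i))

        -- Without descents x is increasing on [i , x(i)), which is impossible if this
        -- interval has more than one element, as x maps x(i) back to i.
        climb : ∀ i m → fun x i ≡ i + 1ℤ + + m → ∀ t → t ≤ m → i + 1ℤ + + m ≤ᶻ fun x (i + + t)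
        climb i m xi≡ zero _ = ℤₚ.≤-reflexive (trans (sym xi≡) (cong (fun x) (sym (ℤₚ.+-identityʳ i))))
        climb i m xi≡ (suc t) 1+t≤m with climb i m xi≡ t (ℕₚ.<⇒≤ 1+t≤m) | ascent (i + + t)
        ... | ih | inj₁ lt = ℤₚ.≤-trans ih (subst (λ u → fun x (i + + t) ≤ᶻ fun x u) (eq i (+ t)) (ℤₚ.<⇒≤ lt))
          where
          eq : ∀ i t → i + t + 1ℤ ≡ i + (1ℤ + t)
          eq = solve-∀
        ... | ih | inj₂ xt≡ = ⊥-elim (by⊥ (gap≤ (subst (i + 1ℤ + + m ≤ᶻ_) xt≡ ih) ⊕ gap≤ (+≤+ 1+t≤m)) (eq i (+ m) (+ t)))
          where
          eq : ∀ i m t → (i + t + 1ℤ - (i + 1ℤ + m)) + (m - (1ℤ + t)) ≡ -1ℤ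
          eq = solve-∀

      -- Write x(i) = i + m + 1. An ascent at i + m would give x(i + m) < x(x(i)) = i, against
      -- `climb`. So x(i + m) = i + m + 1 = x(i), and injectivity yields m = 0.
      excedance : ∀ {i} → i <ᶻ fun x i → fun x i ≡ i + 1ℤ
      excedance {i} i<xi = conclude (ascent (i + + m))
        where
        m = ∣ fun x i - (1ℤ + i) ∣
        eq : ∀ i u → u ≡ i + 1ℤ + (u - (1ℤ + i))
        eq = solve-∀
        xi≡ : fun x i ≡ i + 1ℤ + + m
        xi≡ = trans (eq i (fun x i)) (cong (_+_ (i + 1ℤ)) (sym (ℤₚ.0≤i⇒+∣i∣≡i (gap< i<xi))))
        e₁ : ∀ i m → i + 1ℤ + m ≡ i + m + 1ℤ
        e₁ = solve-∀
        e₂ : ∀ i m v → (v - (i + 1ℤ + m)) + (i - (1ℤ + v)) + (1ℤ + m) ≡ -1ℤ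
        e₂ = solve-∀
        xi≡′ : fun x i ≡ i + + m + 1ℤ
        xi≡′ = trans xi≡ (e₁ i (+ m))
        conclude : fun x (i + + m) <ᶻ fun x (i + + m + 1ℤ) ⊎ fun x (i + + m) ≡ i + + m + 1ℤ → fun x i ≡ i + 1ℤ
        conclude (inj₁ lt) = ⊥-elim (by⊥
          (gap≤ (climb i m xi≡ m ℕₚ.≤-refl)
            ⊕ gap< (subst (fun x (i + + m) <ᶻ_) (trans (cong (fun x) (sym xi≡′)) (xx i)) lt)
            ⊕ +≤+ {0} {suc m} z≤n)
          (e₂ i (+ m) (fun x (i + + m))))
        conclude (inj₂ eq) = trans xi≡′ (cong (_+ 1ℤ) (fun-injective x (trans eq (sym xi≡′))))

      displacement : ∀ i → fun x i ≤ᶻ i + 1ℤ × i ≤ᶻ fun x i + 1ℤ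
      displacement i with ℤₚ.<-cmp i (fun x i)
      ... | tri≈ _ eq _ = ⊥-elim (x≢ i (sym eq))
      ... | tri< lt _ _ = ℤₚ.≤-reflexive (excedance lt) , ℤₚ.<⇒≤ (ℤₚ.<-trans lt (n<n+1 _))
      ... | tri> _ _ gt = ℤₚ.<⇒≤ (ℤₚ.<-trans gt (n<n+1 _)) ,
            ℤₚ.≤-reflexive (trans (sym (xx i)) (excedance (subst (fun x i <ᶻ_) (sym (xx i)) gt)))

      -- The base of the induction. As rxr(a) = r(x(b)), the cases are how `r` acts on x(b). If `r`
      -- fixes it, the bounds of `displacement` squeeze x(b) to a, which `r` moves.
      conj-≮ : ∀ {a b r} → Swap a b r → a <ᶻ b → ¬ (fun (conj r x) a <ᶻ fun x a)
      conj-≮ {a} {b} {r} R a<b ya<xa with subst (_<ᶻ fun x a) (conj-at R x) ya<xa | elsewhere R (fun x b)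
      ... | rxb<xa | inj₂ (inj₁ xb∼b) = image-≁ b xb∼b
      ... | rxb<xa | inj₂ (inj₂ rxb≡xb) = ℤₚ.<-irrefl
            (trans (sym xb≡a) (trans (sym rxb≡xb) (trans (cong (fun r) xb≡a) (a↦b R)))) a<b
        where
        xb<xa = subst (_<ᶻ fun x a) rxb≡xb rxb<xa
        e₁ : ∀ a b u v → a + 1ℤ - u + (u - (1ℤ + v)) ≡ a - v
        e₁ = solve-∀
        e₂ : ∀ a b v → v + 1ℤ - b + (b - (1ℤ + a)) ≡ v - a
        e₂ = solve-∀
        xb≡a : fun x b ≡ a
        xb≡a = ℤₚ.≤-antisym
          (by≤ (gap≤ (proj₁ (displacement a)) ⊕ gap< xb<xa) (e₁ a b (fun x a) (fun x b)))
          (by≤ (gap≤ (proj₂ (displacement b)) ⊕ gap< a<b) (e₂ a b (fun x b)))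
      -- Here x(b) = a + z, hence b = x(a) + z. From a < b and x(a) ≤ a + 1 follows z ≥ 0, so
      -- r(x(b)) = b + z = x(a) + 2z is not below x(a).
      ... | rxb<xa | inj₁ xb∼a@(multiple m eq) = absurd
        where
        z = m * N
        xa≡ : fun x a + z ≡ b
        xa≡ = trans (sym (shift (fun x) px a m)) (trans (cong (fun x) (sym eq)) (xx b))
        rxb≡ : fun r (fun x b) ≡ b + z
        rxb≡ = trans (cong (fun r) eq) (a↦b+ R m)
        e₁ : ∀ a u z → a + 1ℤ - u + (u + z - (1ℤ + a)) ≡ z - 0ℤ
        e₁ = solve-∀
        0≤z : 0ℤ ≤ᶻ z
        0≤z = by≤ (gap≤ (proj₁ (displacement a)) ⊕ gap< (subst (a <ᶻ_) (sym xa≡) a<b)) (e₁ a (fun x a) z)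
        e₂ : ∀ u z → z + z + (u - (1ℤ + (u + z + z))) ≡ -1ℤ
        e₂ = solve-∀
        absurd : ⊥
        absurd = by⊥ (0≤z ⊕ 0≤z ⊕ gap< (subst (_<ᶻ fun x a) (trans rxb≡ (cong (_+ z) (sym xa≡))) rxb<xa))
          (e₂ (fun x a) z)

  -- Exchange property

  module Words (Generator : Perm → Set) (simple : ∀ {s} → Generator s → Simple s) where

    periodic-prod : ∀ {ws} → All Generator ws → Periodic (fun (prod ws))
    periodic-prod []                 i = refl
    periodic-prod (_∷_ {s} {ws} g gs) = periodic-∘ (fun s) (fun (prod ws)) (periodic (proj₂ (simple g))) (periodic-prod gs)

    prod-snoc : ∀ ws s → prod (ws ++ s ∷ []) ≈ (prod ws ∘ₚ s)
    prod-snoc []       s i = refl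
    prod-snoc (v ∷ ws) s i = cong (fun v) (prod-snoc ws s i)

    Shortened : List Perm → Perm → Set
    Shortened ws w = ∃ λ ws′ → All Generator ws′ × suc (length ws′) ≡ length ws × (prod ws′ ≈ w)

    -- The pair is followed through the inverses of the letters from the left. The letter that
    -- inverts it equals the current conjugate of `t` and cancels against it; until then `t` is
    -- moved past each letter by conjugation.
    exchangeˡ : ∀ {a b t ws} → All Generator ws → a <ᶻ b → Swap a b t →
      inv (prod ws) b <ᶻ inv (prod ws) a → Shortened ws (t ∘ₚ prod ws)
    exchangeˡ [] a<b T b<a = ⊥-elim (ℤₚ.<-asym a<b b<a)
    exchangeˡ {a} {b} {t} (_∷_ {s} {ws} g gs) a<b T inverted with ℤₚ.<-cmp (inv s a) (inv s b)
    ... | tri≈ _ eq _ = ⊥-elim (ℤₚ.<-irrefl (fun-injective (s ⁻¹) eq) a<b)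
    ... | tri> _ _ sb<sa = ws , gs , refl , λ j → sym (trans (swap-unique T S (fun s (fun (prod ws) j))) (involutive S _))
      where
      S : Swap a b s
      S = proj₂ (inverted-by-simple (simple g) a<b
            (subst₂ _<ᶻ_ (inv≗fun (proj₂ (simple g)) b) (inv≗fun (proj₂ (simple g)) a) sb<sa))
    ... | tri< sa<sb _ _ with exchangeˡ gs sa<sb (swap-conj (s ⁻¹) (periodic-inv s (periodic (proj₂ (simple g)))) T) inverted
    ...   | ws′ , gs′ , len , eq = s ∷ ws′ , g ∷ gs′ , cong suc len ,
            λ j → trans (cong (fun s) (eq j)) (fun∘inv s _)

    -- If the tail u already inverts the pair, the deleted letter lies in the tail. Otherwise `s`
    -- inverts u(a), u(b), so `s` is the conjugate of `t` by u, and s u t = u.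
    exchangeʳ : ∀ {a b t ws} → All Generator ws → a <ᶻ b → Swap a b t →
      fun (prod ws) b <ᶻ fun (prod ws) a → Shortened ws (prod ws ∘ₚ t)
    exchangeʳ [] a<b T b<a = ⊥-elim (ℤₚ.<-asym a<b b<a)
    exchangeʳ {a} {b} {t} (_∷_ {s} {ws} g gs) a<b T inverted
      with ℤₚ.<-cmp (fun (prod ws) a) (fun (prod ws) b)
    ... | tri≈ _ eq _ = ⊥-elim (ℤₚ.<-irrefl (cong (fun s) (sym eq)) inverted)
    ... | tri> _ _ ub<ua with exchangeʳ gs a<b T ub<ua
    ...   | ws′ , gs′ , len , eq = s ∷ ws′ , g ∷ gs′ , cong suc len , λ j → cong (fun s) (eq j)
    exchangeʳ {a} {b} {t} (_∷_ {s} {ws} g gs) a<b T inverted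
        | tri< ua<ub _ _ = ws , gs , refl , λ j → sym (trans (s≗utu⁻¹ (fun u (fun t j)))
            (cong (fun u) (trans (cong (fun t) (inv∘fun u _)) (involutive T j))))
      where
      u = prod ws
      s≗utu⁻¹ : s ≈ conj u t
      s≗utu⁻¹ = swap-unique (proj₂ (inverted-by-simple (simple g) ua<ub inverted)) (swap-conj u (periodic-prod gs) T)

-- The affine symmetric group

module Affine (k : ℕ) where

  -- Written as `k` plus 2 so that `modN n` computes and the residues 0 and 1 are distinct.
  n : ℕ
  n = suc (suc k)

  open Aff n
  open Periodicity (+ n)
  open Swap

  -- The generators in terms of residues

  private
    -- Displacement under `sfun i` as a plain function of the residue, so that equations between
    -- residues can be applied inside it.
    offset : ℕ → ℤ
    offset zero          = 1ℤ
    offset (suc zero)    = -1ℤ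
    offset (suc (suc _)) = 0ℤ

    sfun-offset : ∀ i j → sfun i j ≡ j + offset ((j - i) %ℕ n)
    sfun-offset i j with (j - i) %ℕ n
    ... | zero        = refl
    ... | suc zero    = refl
    ... | suc (suc _) = sym (ℤₚ.+-identityʳ j)

    sfun-residue : ∀ i q {r} → r ℕ.< n → sfun i (i + + r + q * + n) ≡ i + + r + q * + n + offset r
    sfun-residue i q {r} r<n = trans (sfun-offset i j) (cong (λ m → j + offset m)
        (trans (cong (_%ℕ n) (eq i (+ r) q (+ n))) (%ℕ-unique n q r<n)))
      where
      j = i + + r + q * + n
      eq : ∀ i r q n → i + r + q * n - i ≡ r + q * n
      eq = solve-∀

    0<n : 0 ℕ.< n
    0<n = s≤s z≤n
    1<n : 1 ℕ.< n
    1<n = s≤s (s≤s z≤n)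

    data Residue (i : ℤ) : ℤ → Set where
      residue : ∀ {r} q → r ℕ.< n → Residue i (i + + r + q * + n)

    residue-of : ∀ i j → Residue i j
    residue-of i j = subst (Residue i)
        (trans (ℤₚ.+-assoc i _ _) (trans (cong (_+_ i) (sym (a≡a%ℕn+[a/ℕn]*n (j - i) n))) (eq i j)))
        (residue ((j - i) /ℕ n) (n%ℕd<d (j - i) n))
      where
      eq : ∀ i j → i + (j - i) ≡ j
      eq = solve-∀

    sfun-i : ∀ i q → sfun i (i + q * + n) ≡ i + 1ℤ + q * + n
    sfun-i i q = trans (cong (λ u → sfun i (u + q * + n)) (sym (ℤₚ.+-identityʳ i)))
        (trans (sfun-residue i q 0<n) (eq i q (+ n)))
      where
      eq : ∀ i q n → i + 0ℤ + q * n + 1ℤ ≡ i + 1ℤ + q * n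
      eq = solve-∀

    sfun-1+i : ∀ i q → sfun i (i + 1ℤ + q * + n) ≡ i + q * + n
    sfun-1+i i q = trans (sfun-residue i q 1<n) (eq i q (+ n))
      where
      eq : ∀ i q n → i + 1ℤ + q * n + -1ℤ ≡ i + q * n
      eq = solve-∀

    sfun-fixed : ∀ i q {r} → suc (suc r) ℕ.< n → sfun i (i + + suc (suc r) + q * + n) ≡ i + + suc (suc r) + q * + n
    sfun-fixed i q r<n = trans (sfun-residue i q r<n) (ℤₚ.+-identityʳ _)

    sfun-elsewhere : ∀ i j → j ∼ i ⊎ j ∼ i + 1ℤ ⊎ sfun i j ≡ j
    sfun-elsewhere i j with residue-of i j
    ... | residue {zero} q _          = inj₁ (multiple q (cong (_+ q * + n) (ℤₚ.+-identityʳ i)))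
    ... | residue {suc zero} q _      = inj₂ (inj₁ (multiple q refl))
    ... | residue {suc (suc r)} q r<n = inj₂ (inj₂ (sfun-fixed i q r<n))

    sfun-involutive : ∀ i j → sfun i (sfun i j) ≡ j
    sfun-involutive i j with sfun-elsewhere i j
    ... | inj₁ (multiple q refl)        = trans (cong (sfun i) (sfun-i i q)) (sfun-1+i i q)
    ... | inj₂ (inj₁ (multiple q refl)) = trans (cong (sfun i) (sfun-1+i i q)) (sfun-i i q)
    ... | inj₂ (inj₂ eq)                = trans (cong (sfun i) eq) eq

    sfun-periodic : ∀ i → Periodic (sfun i)
    sfun-periodic i j with residue-of i j
    ... | residue {r} q r<n = trans (cong (sfun i) (e₁ i (+ r) q (+ n))) (trans (sfun-residue i (q + 1ℤ) r<n)
          (trans (e₂ i (+ r) q (+ n) (offset r)) (cong (_+ + n) (sym (sfun-residue i q r<n)))))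
      where
      e₁ : ∀ i r q n → i + r + q * n + n ≡ i + r + (q + 1ℤ) * n
      e₁ = solve-∀
      e₂ : ∀ i r q n u → i + r + (q + 1ℤ) * n + u ≡ i + r + q * n + u + n
      e₂ = solve-∀

  simple-perm : ℤ → Perm
  simple-perm i = record { fun = sfun i ; inv = sfun i ; inv∘fun = sfun-involutive i ; fun∘inv = sfun-involutive i }

  simple-perm-swap : ∀ i → Swap i (i + 1ℤ) (simple-perm i)
  simple-perm-swap i = record
    { periodic = sfun-periodic i
    ; a↦b = subst₂ (λ u v → sfun i u ≡ v) (ℤₚ.+-identityʳ i) (ℤₚ.+-identityʳ _) (sfun-i i 0ℤ)
    ; b↦a = subst₂ (λ u v → sfun i u ≡ v) (ℤₚ.+-identityʳ (i + 1ℤ)) (ℤₚ.+-identityʳ i) (sfun-1+i i 0ℤ)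
    ; elsewhere = sfun-elsewhere i }

  isSimple⇒simple : ∀ s → IsSimple s → Simple s
  isSimple⇒simple s (i , _ , _ , s≗) = + i , swap-resp-≈ (λ j → sym (s≗ j)) (simple-perm-swap (+ i))

  open Words IsSimple (λ {s} → isSimple⇒simple s)

  -- Sums over one period

  sumTo-cong : ∀ {f g} → (∀ j → f j ≡ g j) → ∀ m → sumTo f m ≡ sumTo g m
  sumTo-cong f≗g zero    = refl
  sumTo-cong f≗g (suc m) = cong₂ _+_ (sumTo-cong f≗g m) (f≗g (+ suc m))

  sumTo-+ : ∀ f g m → sumTo (λ j → f j + g j) m ≡ sumTo f m + sumTo g m
  sumTo-+ f g zero    = refl
  sumTo-+ f g (suc m) = trans (cong (_+ (f (+ suc m) + g (+ suc m))) (sumTo-+ f g m)) (eq (sumTo f m) (sumTo g m) (f (+ suc m)) (g (+ suc m)))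
    where
    eq : ∀ a b c d → a + b + (c + d) ≡ a + c + (b + d)
    eq = solve-∀

  -- Moving the window by one trades the value at 1 for the value at `suc n`, and these agree by
  -- periodicity.
  sumTo-rotate : ∀ g → (∀ j → g (j + + n) ≡ g j) → ∀ c → sumTo (λ j → g (j + + c)) n ≡ sumTo g n
  sumTo-rotate g gn zero    = sumTo-cong (λ j → cong g (ℤₚ.+-identityʳ j)) n
  sumTo-rotate g gn (suc c) = begin
    sumTo (λ j → g (j + + suc c)) n  ≡⟨ sumTo-cong (λ j → cong g (e₁ j (+ c))) n ⟩
    sumTo (λ j → h (j + 1ℤ)) n       ≡⟨ ∙-cancelʳ (h 1ℤ) _ _ (trans (telescope n) (cong (_+_ (sumTo h n)) h-wrap)) ⟩
    sumTo h n                        ≡⟨ sumTo-rotate g gn c ⟩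
    sumTo g n                        ∎
    where
    open ≡-Reasoning
    h : ℤ → ℤ
    h j = g (j + + c)
    e₁ : ∀ j c → j + (1ℤ + c) ≡ j + 1ℤ + c
    e₁ = solve-∀
    e₂ : ∀ n c → 1ℤ + n + c ≡ 1ℤ + c + n
    e₂ = solve-∀
    e₃ : ∀ a b c → a + b + c ≡ a + c + b
    e₃ = solve-∀
    h-wrap : h (+ suc n) ≡ h 1ℤ
    h-wrap = trans (cong g (e₂ (+ n) (+ c))) (gn (1ℤ + + c))
    telescope : ∀ m → sumTo (λ j → h (j + 1ℤ)) m + h 1ℤ ≡ sumTo h m + h (+ suc m)
    telescope zero    = refl
    telescope (suc m) = trans (e₃ (sumTo (λ j → h (j + 1ℤ)) m) (h (+ suc m + 1ℤ)) (h 1ℤ))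
      (cong₂ _+_ (telescope m) (cong h (ℤₚ.+-comm (+ suc m) 1ℤ)))

  -- After rotating the period to start at i, only the first two terms of
  -- Σ (f(s_i(j)) - f(j)) are non-zero, and they cancel.
  sumTo-∘-simple : ∀ {f s} → Periodic f → IsSimple s → sumTo (λ j → f (fun s j)) n ≡ sumTo f n
  sumTo-∘-simple {f} {s} pf (suc c , s≤s _ , _ , s≗) = begin
    sumTo (λ j → f (fun s j)) n    ≡⟨ sumTo-cong (λ j → trans (cong f (s≗ j)) (e₁ _ (f j))) n ⟩
    sumTo (λ j → f j + D j) n      ≡⟨ sumTo-+ f D n ⟩
    sumTo f n + sumTo D n          ≡⟨ cong (_+_ (sumTo f n)) (trans (sym (sumTo-rotate D D-wrap c)) (vanish k ℕₚ.≤-refl)) ⟩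
    sumTo f n + 0ℤ                 ≡⟨ ℤₚ.+-identityʳ _ ⟩
    sumTo f n                      ∎
    where
    open ≡-Reasoning
    i = + suc c
    D : ℤ → ℤ
    D j = f (sfun i j) - f j
    e₁ : ∀ u v → u ≡ v + (u - v)
    e₁ = solve-∀
    e₂ : ∀ u v n → (u + n) - (v + n) ≡ u - v
    e₂ = solve-∀
    D-wrap : ∀ j → D (j + + n) ≡ D j
    D-wrap j = trans (cong₂ _-_ (trans (cong f (sfun-periodic i j)) (pf (sfun i j))) (pf j)) (e₂ (f (sfun i j)) (f j) (+ n))
    e₃ : ∀ c t n → (1ℤ + t) + c ≡ 1ℤ + c + t + 0ℤ * n
    e₃ = solve-∀
    D-at : ∀ t → t ℕ.< n → D (+ suc t + + c) ≡ f (i + + t + 0ℤ * + n + offset t) - f (i + + t + 0ℤ * + n)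
    D-at t t<n = trans (cong D (e₃ (+ c) (+ t) (+ n))) (cong (λ u → f u - f (i + + t + 0ℤ * + n)) (sfun-residue i 0ℤ t<n))
    e₄ : ∀ i z → i + 0ℤ + z + 1ℤ ≡ i + 1ℤ + z
    e₄ = solve-∀
    e₅ : ∀ i z → i + 1ℤ + z + -1ℤ ≡ i + 0ℤ + z
    e₅ = solve-∀
    e₆ : ∀ u v → 0ℤ + (u - v) + (v - u) ≡ 0ℤ
    e₆ = solve-∀
    vanish : ∀ m → m ≤ k → sumTo (λ j → D (j + + c)) (suc (suc m)) ≡ 0ℤ
    vanish zero    _   = trans
      (cong₂ (λ u v → 0ℤ + u + v)
        (trans (D-at 0 0<n) (cong (λ u → f u - f (i + 0ℤ + 0ℤ * + n)) (e₄ i (0ℤ * + n))))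
        (trans (D-at 1 1<n) (cong (λ u → f u - f (i + 1ℤ + 0ℤ * + n)) (e₅ i (0ℤ * + n)))))
      (e₆ (f (i + 1ℤ + 0ℤ * + n)) (f (i + 0ℤ + 0ℤ * + n)))
    vanish (suc m) m<k = cong₂ _+_ (vanish m (ℕₚ.<⇒≤ m<k))
      (trans (D-at (suc (suc m)) (s≤s (s≤s m<k)))
        (ℤₚ.i≡j⇒i-j≡0 (cong f (ℤₚ.+-identityʳ (i + + suc (suc m) + 0ℤ * + n)))))

  -- Stated for every periodic `f` because the induction absorbs the first letter into `f`.
  sumTo-∘-prod : ∀ {f ws} → Periodic f → All IsSimple ws → sumTo (λ j → f (fun (prod ws) j)) n ≡ sumTo f n
  sumTo-∘-prod pf [] = refl
  sumTo-∘-prod {f} {s ∷ ws} pf (g ∷ gs) = trans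
    (sumTo-∘-prod {λ j → f (fun s j)} (periodic-∘ f (fun s) pf (periodic (proj₂ (isSimple⇒simple s g)))) gs)
    (sumTo-∘-simple {f} {s} pf g)

  InW-resp-≈ : ∀ v w → v ≈ w → InW v → InW w
  InW-resp-≈ v w v≈w (pv , sum) = periodic-≗ v≈w pv , trans (sumTo-cong (λ j → sym (v≈w j)) n) sum

  isSimple⇒InW : ∀ s → IsSimple s → InW s
  isSimple⇒InW s g = periodic (proj₂ (isSimple⇒simple s g)) , sumTo-∘-simple {λ j → j} {s} (λ _ → refl) g

  -- Length and height

  module Length (ℓ : Perm → ℕ) (isLength : IsCoxeterLength ℓ) where

    sumTo-∘ : ∀ f w → Periodic f → InW w → sumTo (λ j → f (fun w j)) n ≡ sumTo f n
    sumTo-∘ f w pf w∈W with proj₁ (isLength w w∈W)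
    ... | ws , gs , _ , ws≈w = trans (sumTo-cong (λ j → cong f (sym (ws≈w j))) n) (sumTo-∘-prod pf gs)

    -- Precomposing with `w` keeps the sum over a period and cancels `inv w`; reindexing by `x` then
    -- leaves the sum of `w`.
    InW-conj : ∀ w x → InW w → InW x → InW (conj w x)
    InW-conj w x w∈W x∈W = pwxw⁻¹ ,
      (begin
        sumTo (λ j → fun w (fun x (inv w j))) n                 ≡⟨ sumTo-∘ (λ j → fun w (fun x (inv w j))) w pwxw⁻¹ w∈W ⟨
        sumTo (λ j → fun w (fun x (inv w (fun w j)))) n         ≡⟨ sumTo-cong (λ j → cong (λ u → fun w (fun x u)) (inv∘fun w j)) n ⟩
        sumTo (λ j → fun w (fun x j)) n                         ≡⟨ sumTo-∘ (fun w) x (proj₁ w∈W) x∈W ⟩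
        sumTo (fun w) n                                         ≡⟨ proj₂ w∈W ⟩
        sumTo (λ j → j) n                                       ∎)
      where
      open ≡-Reasoning
      pwxw⁻¹ = periodic-∘ (fun w) (fun (x ∘ₚ (w ⁻¹))) (proj₁ w∈W)
        (periodic-∘ (fun x) (inv w) (proj₁ x∈W) (periodic-inv w (proj₁ w∈W)))

    InFPF-conj : ∀ w x → InW w → InFPF x → InFPF (conj w x)
    InFPF-conj w x w∈W (x∈W , xx , x≢) = InW-conj w x w∈W x∈W
      , (λ i → trans (cong (λ u → fun w (fun x u)) (inv∘fun w _)) (trans (cong (fun w) (xx (inv w i))) (fun∘inv w i)))
      , (λ i eq → x≢ (inv w i) (trans (sym (inv∘fun w _)) (cong (inv w) eq)))

    isRefl⇒InW : ∀ r → IsRefl r → InW r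
    isRefl⇒InW r (w , s , w∈W , g , r≈) = InW-resp-≈ (conj w s) r (λ j → sym (r≈ j)) (InW-conj w s w∈W (isSimple⇒InW s g))

    isRefl⇒swap : ∀ r → IsRefl r → ∃ λ a → ∃ λ b → a <ᶻ b × Swap a b r
    isRefl⇒swap r (w , s , w∈W , g , r≈) with isSimple⇒simple s g
    ... | i , S with ℤₚ.<-cmp (fun w i) (fun w (i + 1ℤ)) | swap-resp-≈ (λ j → sym (r≈ j)) (swap-conj w (proj₁ w∈W) S)
    ...   | tri< lt _ _ | R = _ , _ , lt , R
    ...   | tri> _ _ gt | R = _ , _ , gt , swap-sym R
    ...   | tri≈ _ eq _ | _ = ⊥-elim (ℤₚ.<-irrefl
            (fun-injective w eq) (n<n+1 i))

    ht : Perm → ℤ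
    ht = htFPF ℓ

    ℓ-≤ : ∀ w {ws} → InW w → All IsSimple ws → prod ws ≈ w → ℓ w ≤ length ws
    ℓ-≤ w w∈W = proj₂ (isLength _ w∈W) _

    ℓ-resp-≈ : ∀ v w → InW v → v ≈ w → ℓ v ≡ ℓ w
    ℓ-resp-≈ v w v∈W v≈w = ℕₚ.≤-antisym (half v w v∈W w∈W (λ j → sym (v≈w j))) (half w v w∈W v∈W v≈w)
      where
      w∈W = InW-resp-≈ v w v≈w v∈W
      half : ∀ x y → InW x → InW y → y ≈ x → ℓ x ≤ ℓ y
      half x y x∈W y∈W y≈x with proj₁ (isLength y y∈W)
      ... | ws , gs , len , ws≈y = subst (ℓ x ≤_) len (ℓ-≤ x x∈W gs (λ j → trans (ws≈y j) (y≈x j)))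

    ℓ-conj-simple : ∀ s x → IsSimple s → InW x → ℓ (conj s x) ≤ ℓ x ℕ.+ 2
    ℓ-conj-simple s x g x∈W with proj₁ (isLength x x∈W)
    ... | ws , gs , len , ws≈x = subst (ℓ (conj s x) ≤_) len′
          (ℓ-≤ (conj s x) {s ∷ ws ++ s ∷ []} (InW-conj s x (isSimple⇒InW s g) x∈W) (g ∷ ++⁺ gs (g ∷ []))
            (λ j → cong (fun s) (trans (prod-snoc ws s j) (trans (ws≈x (fun s j))
              (cong (fun x) (sym (inv≗fun (proj₂ (isSimple⇒simple s g)) j)))))))
      where
      len′ : length (s ∷ ws ++ s ∷ []) ≡ ℓ x ℕ.+ 2
      len′ = trans (cong suc (length-++ ws)) (trans (sym (ℕₚ.+-suc (length ws) 1)) (cong (ℕ._+ 2) len))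

    private
      -- Adding 2 to the length shifts the numerator by the divisor, so the rounded quotient grows
      -- by exactly one whatever the parity.
      ht+1 : ∀ x → (+ (ℓ x ℕ.+ 2) - + (n ℕ./ 2)) /ℕ 2 ≡ ht x + 1ℤ
      ht+1 x = trans (cong (_/ℕ 2) (eq (+ ℓ x) (+ (n ℕ./ 2)))) (/ℕ-shift 2 (+ ℓ x - + (n ℕ./ 2)))
        where
        eq : ∀ a c → a + + 2 - c ≡ a - c + + 2
        eq = solve-∀

    ht-drop : ∀ x y → ℓ x ℕ.+ 2 ≤ ℓ y → ht x + 1ℤ ≤ᶻ ht y
    ht-drop x y le = subst (_≤ᶻ ht y) (ht+1 x) (/ℕ-mono 2 (ℤₚ.+-monoˡ-≤ (- (+ (n ℕ./ 2))) (+≤+ le)))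

    ht-rise : ∀ x y → ℓ x ≤ ℓ y ℕ.+ 2 → ht x ≤ᶻ ht y + 1ℤ
    ht-rise x y le = subst (ht x ≤ᶻ_) (ht+1 y) (/ℕ-mono 2 (ℤₚ.+-monoˡ-≤ (- (+ (n ℕ./ 2))) (+≤+ le)))

    ht-resp-≈ : ∀ x y → InW x → x ≈ y → ht x ≡ ht y
    ht-resp-≈ x y x∈W x≈y = cong (λ m → (+ m - + (n ℕ./ 2)) /ℕ 2) (ℓ-resp-≈ x y x∈W x≈y)

    ht-conj-simple-≤ : ∀ s x → IsSimple s → InFPF x → ht (conj s x) ≤ᶻ ht x + 1ℤ
    ht-conj-simple-≤ s x g x∈X = ht-rise (conj s x) x (ℓ-conj-simple s x g (proj₁ x∈X))

    -- The previous bound applied to sxs, which conjugation by `s` takes back to x.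
    ht-≤-conj-simple : ∀ s x → IsSimple s → InFPF x → ht x ≤ᶻ ht (conj s x) + 1ℤ
    ht-≤-conj-simple s x g x∈X = subst (_≤ᶻ ht (conj s x) + 1ℤ)
      (ht-resp-≈ (conj s (conj s x)) x (InW-conj s (conj s x) s∈W (InW-conj s x s∈W (proj₁ x∈X)))
        (conj-involutive (proj₂ (isSimple⇒simple s g)) x))
      (ht-conj-simple-≤ s (conj s x) g (InFPF-conj s x s∈W x∈X))
      where s∈W = isSimple⇒InW s g

    module Involution (x : Perm) (x∈X : InFPF x) where

      open FixedPointFree x (proj₁ (proj₁ x∈X)) (proj₁ (proj₂ x∈X)) (proj₂ (proj₂ x∈X)) public

      -- Since x is its own inverse, the descent permits an exchange on the left of a shortest word,
      -- giving a word for sx with one letter less. By `descent-persists` sx still inverts i and i +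
      -- 1, so an exchange on the right removes another letter.
      ℓ-conj-descent : ∀ {i s} → IsSimple s → Swap i (i + 1ℤ) s → Descent i → ℓ (conj s x) ℕ.+ 2 ≤ ℓ x
      ℓ-conj-descent {i} {s} g S d with proj₁ (isLength x (proj₁ x∈X))
      ... | ws , gs , len , ws≈x with exchangeˡ gs (n<n+1 i) S
              (subst₂ _<ᶻ_ (x≗ws⁻¹ (i + 1ℤ)) (x≗ws⁻¹ i) (proj₁ d))
        where
        x≗ws⁻¹ : ∀ j → fun x j ≡ inv (prod ws) j
        x≗ws⁻¹ j = sym (trans (cong (inv (prod ws)) (sym (trans (ws≈x _) (proj₁ (proj₂ x∈X) j)))) (inv∘fun (prod ws) (fun x j)))
      ...   | ws′ , gs′ , len′ , ws′≈ with exchangeʳ gs′ (n<n+1 i) S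
                (subst₂ _<ᶻ_ (sym (ws′≗sx (i + 1ℤ))) (sym (ws′≗sx i)) (descent-persists S d))
        where
        ws′≗sx : ∀ j → fun (prod ws′) j ≡ fun s (fun x j)
        ws′≗sx j = trans (ws′≈ j) (cong (fun s) (ws≈x j))
      ...     | ws″ , gs″ , len″ , ws″≈ = ℕₚ.≤-trans
                (ℕₚ.+-monoˡ-≤ 2 (ℓ-≤ (conj s x) (InW-conj s x (isSimple⇒InW s g) (proj₁ x∈X)) gs″
                  (λ j → trans (ws″≈ j) (trans (ws′≈ _) (cong (fun s) (trans (ws≈x _) (cong (fun x) (sym (inv≗fun S j)))))))))
                (ℕₚ.≤-reflexive (trans (ℕₚ.+-comm _ 2) (trans (cong suc len″) (trans len′ len))))

      -- Descents are invariant under translation by `n`, so the representatives 1 to `n` decide;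
      -- the index `c` of the search stands for the position c + 1.
      find-descent : (∃ λ s → IsSimple s × ∃ λ i → Swap i (i + 1ℤ) s × Descent i) ⊎ (∀ i → ¬ Descent i)
      find-descent with ℕₚ.anyUpTo? (λ c → descent? (+ suc c)) n
      ... | yes (c , c<n , d) = inj₁ (simple-perm (+ suc c) , (suc c , s≤s z≤n , c<n , λ _ → refl)
            , + suc c , simple-perm-swap (+ suc c) , d)
      ... | no none = inj₂ λ i d → none (((i - 1ℤ) %ℕ n) , n%ℕd<d (i - 1ℤ) n , descent-shift (multiple-of i) d)
        where
        e₁ : ∀ i → i ≡ i - 1ℤ + 1ℤ
        e₁ = solve-∀
        e₂ : ∀ r q n → r + q * n + 1ℤ ≡ 1ℤ + r + q * n
        e₂ = solve-∀
        multiple-of : ∀ i → i ∼ + suc ((i - 1ℤ) %ℕ n)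
        multiple-of i = multiple q (trans (e₁ i)
          (trans (cong (_+ 1ℤ) (a≡a%ℕn+[a/ℕn]*n (i - 1ℤ) n)) (e₂ (+ r) q (+ n))))
          where
          q = (i - 1ℤ) /ℕ n
          r = (i - 1ℤ) %ℕ n

      conj-inverting : ∀ {a b r s} → Simple s → Swap a b r →
        (fun (conj r x) a <ᶻ fun x a × fun s (fun x a) <ᶻ fun s (fun (conj r x) a)) ⊎
        (fun x a <ᶻ fun (conj r x) a × fun s (fun (conj r x) a) <ᶻ fun s (fun x a)) →
        conj r x ≈ conj s x
      conj-inverting S R (inj₁ (lt , gt)) = conj-agree R
        (swap-sym (proj₂ (inverted-by-simple S lt gt))) (λ eq → ℤₚ.<-irrefl (sym eq) lt)
      conj-inverting S R (inj₂ (lt , gt)) = conj-agree R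
        (proj₂ (inverted-by-simple S lt gt)) (λ eq → ℤₚ.<-irrefl eq lt)

    -- Heights under conjugation by a reflection

    private
      descend : ∀ x y r {i s} (x∈X : InFPF x) → InFPF y → IsSimple s → Swap i (i + 1ℤ) s →
        Involution.Descent x x∈X i → y ≈ conj r x → conj r x ≈ conj s x → ht y <ᶻ ht x
      descend x y r {s = s} x∈X y∈X g S d y≈ rx≈sx = ≤-suc⇒< (subst (λ u → u + 1ℤ ≤ᶻ ht x)
        (sym (ht-resp-≈ y (conj s x) (proj₁ y∈X) (λ j → trans (y≈ j) (rx≈sx j))))
        (ht-drop (conj s x) x (Involution.ℓ-conj-descent x x∈X g S d)))

      -- Induction on ℓ(x) along a descent `s` of `x`. If `s` inverts a, b or the pair y(a), x(a),
      -- then y = sxs and the descent itself lowers the height. Otherwise the claim for sxs, sys and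
      -- srs gives ht(y) ≤ ht(sys) + 1 ≤ ht(sxs) < ht(x). Keeping `y` apart from `conj r x` lets the
      -- two change places.
      ht-conj-< : ∀ x y r {a b} → Acc ℕ._<_ (ℓ x) → InFPF x → InFPF y → y ≈ conj r x →
        Swap a b r → a <ᶻ b → fun y a <ᶻ fun x a → ht y <ᶻ ht x
      ht-conj-< x y r {a} {b} (acc rec) x∈X y∈X y≈ R a<b ya<xa with Involution.find-descent x x∈X
      ... | inj₂ none = ⊥-elim (Involution.WithoutDescents.conj-≮ x x∈X none R a<b
              (subst (_<ᶻ fun x a) (y≈ a) ya<xa))
      ... | inj₁ (s , g , i , S , d) with ℤₚ.<-cmp (fun s a) (fun s b) | ℤₚ.<-cmp (fun s (fun y a)) (fun s (fun x a))
      ...   | tri≈ _ eq _ | _ = ⊥-elim (ℤₚ.<-irrefl (fun-injective s eq) a<b)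
      ...   | tri> _ _ sb<sa | _ = descend x y r x∈X y∈X g S d y≈
              (conj-resp-≈ r s x x (swap-unique R (proj₂ (inverted-by-simple (isSimple⇒simple s g) a<b sb<sa))) (λ _ → refl))
      ...   | tri< sa<sb _ _ | tri≈ _ eq _ = ⊥-elim (ℤₚ.<-irrefl (fun-injective s eq) ya<xa)
      ...   | tri< sa<sb _ _ | tri> _ _ sxa<sya = descend x y r x∈X y∈X g S d y≈
              (Involution.conj-inverting x x∈X (isSimple⇒simple s g) R
                (inj₁ (subst (_<ᶻ fun x a) (y≈ a) ya<xa , subst (λ u → fun s (fun x a) <ᶻ fun s u) (y≈ a) sxa<sya)))
      ...   | tri< sa<sb _ _ | tri< sya<sxa _ _ = ℤₚ.≤-<-trans
              (ℤₚ.≤-trans (ht-≤-conj-simple s y g y∈X) (<⇒suc-≤ ih))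
              (≤-suc⇒< (ht-drop (conj s x) x ℓ-lt))
        where
        s∈W = isSimple⇒InW s g
        ℓ-lt : ℓ (conj s x) ℕ.+ 2 ≤ ℓ x
        ℓ-lt = Involution.ℓ-conj-descent x x∈X g S d
        ih : ht (conj s y) <ᶻ ht (conj s x)
        ih = ht-conj-< (conj s x) (conj s y) (conj s r) (rec (ℕₚ.<-≤-trans (ℕₚ.m<m+n _ (s≤s z≤n)) ℓ-lt))
          (InFPF-conj s x s∈W x∈X) (InFPF-conj s y s∈W y∈X)
          (λ j → trans (conj-resp-≈ s s y (conj r x) (λ _ → refl) y≈ j) (conj-conj s r x j))
          (swap-conj s (periodic S) R) sa<sb
          (subst₂ _<ᶻ_ (sym (conj-image s y a)) (sym (conj-image s x a)) sya<sxa)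

    -- The last case is the first with `x` and its conjugate exchanged, as conjugating by `r` twice
    -- returns `x`.
    ht-conj-trichotomy : ∀ x r {a b} → InFPF x → InW r → Swap a b r → a <ᶻ b →
      (fun (conj r x) a <ᶻ fun x a × ht (conj r x) <ᶻ ht x) ⊎
      conj r x ≈ x ⊎
      (fun x a <ᶻ fun (conj r x) a × ht x <ᶻ ht (conj r x))
    ht-conj-trichotomy x r {a} {b} x∈X r∈W R a<b with ℤₚ.<-cmp (fun (conj r x) a) (fun x a)
    ... | tri< lt _ _ = inj₁ (lt , ht-conj-< x (conj r x) r (<-wellFounded _) x∈X (InFPF-conj r x r∈W x∈X) (λ _ → refl) R a<b lt)
    ... | tri≈ _ eq _ = inj₂ (inj₁ (Involution.conj-fixes x x∈X R (λ a≡b → ℤₚ.<-irrefl a≡b a<b) eq))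
    ... | tri> _ _ gt = inj₂ (inj₂ (gt , ht-conj-< (conj r x) x r (<-wellFounded _) (InFPF-conj r x r∈W x∈X) x∈X
            (λ j → sym (conj-involutive R x j)) R a<b gt))

    -- The first hypothesis means x(a) < rxr(a). If `s` inverts a, b it equals `r`; if it inverts
    -- x(a), rxr(a), then `conj-inverting` concludes. Otherwise both orders survive conjugation by
    -- `s`, so ht(sxs) < ht(srxrs), against the second hypothesis.
    QP2 : ∀ r x s → IsRefl r → InFPF x → IsSimple s →
      ht x <ᶻ ht (conj r x) → ht (conj s (conj r x)) <ᶻ ht (conj s x) → conj r x ≈ conj s x
    QP2 r x s ρ x∈X g x<rx srx<sx with isRefl⇒swap r ρ
    ... | a , b , a<b , R with ht-conj-trichotomy x r x∈X (isRefl⇒InW r ρ) R a<b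
    ...   | inj₁ (_ , rx<x) = ⊥-elim (ℤₚ.<-asym x<rx rx<x)
    ...   | inj₂ (inj₁ rx≈x) = ⊥-elim (ℤₚ.<-irrefl
              (sym (ht-resp-≈ (conj r x) x (InW-conj r x (isRefl⇒InW r ρ) (proj₁ x∈X)) rx≈x)) x<rx)
    ...   | inj₂ (inj₂ (xa<ya , _)) with ℤₚ.<-cmp (fun s a) (fun s b) | ℤₚ.<-cmp (fun s (fun x a)) (fun s (fun (conj r x) a))
    ...     | tri≈ _ eq _ | _ = ⊥-elim (ℤₚ.<-irrefl (fun-injective s eq) a<b)
    ...     | tri> _ _ sb<sa | _ = conj-resp-≈ r s x x
              (swap-unique R (proj₂ (inverted-by-simple (isSimple⇒simple s g) a<b sb<sa))) (λ _ → refl)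
    ...     | tri< _ _ _ | tri≈ _ eq _ = ⊥-elim (ℤₚ.<-irrefl (fun-injective s eq) xa<ya)
    ...     | tri< _ _ _ | tri> _ _ sya<sxa = Involution.conj-inverting x x∈X (isSimple⇒simple s g) R (inj₂ (xa<ya , sya<sxa))
    ...     | tri< sa<sb _ _ | tri< sxa<sya _ _ = ⊥-elim (ℤₚ.<-asym srx<sx
              (ht-conj-< (conj s (conj r x)) (conj s x) (conj s r) (<-wellFounded _)
                 (InFPF-conj s (conj r x) s∈W rx∈X) (InFPF-conj s x s∈W x∈X)
                 (sx≈ R) (swap-conj s (periodic (proj₂ (isSimple⇒simple s g))) R) sa<sb
                 (subst₂ _<ᶻ_ (sym (conj-image s x a)) (sym (conj-image s (conj r x) a)) sxa<sya)))
      where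
      s∈W = isSimple⇒InW s g
      rx∈X = InFPF-conj r x (isRefl⇒InW r ρ) x∈X
      sx≈ : ∀ {a b} → Swap a b r → conj s x ≈ conj (conj s r) (conj s (conj r x))
      sx≈ R j = trans (conj-resp-≈ s s x (conj r (conj r x)) (λ _ → refl) (λ i → sym (conj-involutive R x i)) j)
        (conj-conj s r (conj r x) j)

    quasiparabolic : IsQuasiparabolic InFPF conj ht
    quasiparabolic = record
      { wset = record
          { closed = λ w x w∈W x∈X → InFPF-conj w x w∈W x∈X
          ; act-id = λ x _ i → refl
          ; act-∘ = λ v w x _ _ _ i → refl
          ; act-resp = λ w w′ x x′ _ _ w≈w′ x≈x′ → conj-resp-≈ w w′ x x′ w≈w′ x≈x′ }
      ; ht-resp = λ x y x∈X x≈y → ht-resp-≈ x y (proj₁ x∈X) x≈y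
      ; scaled = λ s x g x∈X → distance-≤1 (ht-conj-simple-≤ s x g x∈X) (ht-≤-conj-simple s x g x∈X)
      ; QP1 = QP1
      ; QP2 = QP2 }
      where
      QP1 : ∀ r x → IsRefl r → InFPF x → ht (conj r x) ≡ ht x → conj r x ≈ x
      QP1 r x ρ x∈X eq with isRefl⇒swap r ρ
      ... | a , b , a<b , R with ht-conj-trichotomy x r x∈X (isRefl⇒InW r ρ) R a<b
      ...   | inj₁ (_ , lt)        = ⊥-elim (ℤₚ.<-irrefl eq lt)
      ...   | inj₂ (inj₁ rx≈x)     = rx≈x
      ...   | inj₂ (inj₂ (_ , gt)) = ⊥-elim (ℤₚ.<-irrefl (sym eq) gt)

theorem4p8 : (n : ℕ) → 2 ≤ n → 2 ∣ n →
    (ℓ : Perm → ℕ) → Aff.IsCoxeterLength n ℓ →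
    Aff.IsQuasiparabolic n (Aff.InFPF n) conj (Aff.htFPF n ℓ)
theorem4p8 (suc (suc k)) _ _ ℓ isLength = Affine.Length.quasiparabolic k ℓ isLength
theorem4p8 (suc zero) (s≤s ()) _ _ _
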